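{- For every real number $\alpha>2$, there exists an infinite $\alpha$-power-free word over $\{0,1\}$ that contains a square beginning at every position.
   Context: For a real number $\beta$, a finite word $w$ is a $\beta$-power if $w = x^n x'$ with $x$ nonempty, $x'$ a prefix of $x$, and $\beta = n + |x'|/|x|$. A word is $\alpha$-power-free if none of its factors (contiguous subwords) is an $\alpha$-power. A square is a word $xx$ with $x$ nonempty. -}

module Defs where

open import Data.Integer.Base using (+_)
open import Data.List.Base using (List; _++_; concat; replicate; length; applyUpTo)
open import Data.List.NonEmpty as List⁺ using (List⁺; toList)
open import Data.List.Relation.Binary.Prefix.Heterogeneous using (Prefix)
open import Data.Nat.Base as ℕ using (ℕ)
open import Data.Product.Base using (∃-syntax; _×_; _,_)
open import Data.Rational.Base as ℚ using (ℚ; _/_; 0ℚ; 1ℚ)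
open import Data.Rational.Properties as ℚ
  using (<-dense; <-trans; <-asym; <-cmp; +-monoʳ-<; +-identityʳ; positive⁻¹; negative⁻¹)
open import Data.Sum.Base using (_⊎_; inj₁; inj₂)
open import Level using (0ℓ)
open import Relation.Binary.Definitions using (tri<; tri≈; tri>)
open import Relation.Binary.PropositionalEquality using (_≡_; refl; subst)
open import Relation.Nullary.Negation using (¬_)
open import Relation.Unary using (Pred; _∈_; _≐_)

-- Real numbers, as two-sided (located) Dedekind cuts of ℚ.

record ℝ : Set₁ where
  field
    lower upper : Pred ℚ 0ℓ
    lower-inhabited : ∃[ q ] q ∈ lower
    upper-inhabited : ∃[ q ] q ∈ upper
    lower-closed    : ∀ {p q} → p ℚ.< q → q ∈ lower → p ∈ lower
    upper-closed    : ∀ {p q} → p ℚ.< q → p ∈ upper → q ∈ upper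
    lower-open      : ∀ {p} → p ∈ lower → ∃[ q ] p ℚ.< q × q ∈ lower
    upper-open      : ∀ {q} → q ∈ upper → ∃[ p ] p ℚ.< q × p ∈ upper
    disjoint        : ∀ {q} → q ∈ lower → ¬ (q ∈ upper)
    located         : ∀ {p q} → p ℚ.< q → p ∈ lower ⊎ q ∈ upper

open ℝ public using (lower; upper)

infix 4 _≈ᴿ_ _<ᴿ_

_≈ᴿ_ : ℝ → ℝ → Set
x ≈ᴿ y = lower x ≐ lower y × upper x ≐ upper y

_<ᴿ_ : ℝ → ℝ → Set
x <ᴿ y = ∃[ q ] q ∈ upper x × q ∈ lower y

fromℚ : ℚ → ℝ
fromℚ r = record
  { lower           = λ q → q ℚ.< r
  ; upper           = λ q → r ℚ.< q
  ; lower-inhabited = r ℚ.+ (ℚ.- 1ℚ) ,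
      subst (r ℚ.+ (ℚ.- 1ℚ) ℚ.<_) (+-identityʳ r) (+-monoʳ-< r (negative⁻¹ (ℚ.- 1ℚ)))
  ; upper-inhabited = r ℚ.+ 1ℚ ,
      subst (ℚ._< r ℚ.+ 1ℚ) (+-identityʳ r) (+-monoʳ-< r (positive⁻¹ 1ℚ))
  ; lower-closed    = <-trans
  ; upper-closed    = λ p<q r<p → <-trans r<p p<q
  ; lower-open      = λ p<r → let m , p<m , m<r = <-dense p<r in m , p<m , m<r
  ; upper-open      = λ r<q → let m , r<m , m<q = <-dense r<q in m , m<q , r<m
  ; disjoint        = <-asym
  ; located         = loc
  }
  where
  loc : ∀ {p q} → p ℚ.< q → p ℚ.< r ⊎ r ℚ.< q
  loc {p} p<q with <-cmp p r
  ... | tri< p<r _    _   = inj₁ p<r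
  ... | tri≈ _   refl _   = inj₂ p<q
  ... | tri> _   _    r<p = inj₂ (<-trans r<p p<q)

-- Words: finite words are lists, nonempty ones List⁺, infinite ones ℕ → A.

module _ {A : Set} where

  exponent : ℕ → List⁺ A → List A → ℚ
  exponent n x x′ = + n / 1 ℚ.+ + length x′ / List⁺.length x

  IsPower : ℝ → List A → Set
  IsPower β w = ∃[ x ] ∃[ n ] ∃[ x′ ]
      Prefix _≡_ x′ (toList x)
    × w ≡ concat (replicate n (toList x)) ++ x′
    × β ≈ᴿ fromℚ (exponent n x x′)

  IsSquare : List A → Set
  IsSquare w = ∃[ x ] w ≡ toList x ++ toList x

  -- The factor of length ℓ beginning at position i (positions start at 0).
  factor : (ℕ → A) → ℕ → ℕ → List A
  factor w i ℓ = applyUpTo (λ k → w (i ℕ.+ k)) ℓ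

  PowerFree : ℝ → (ℕ → A) → Set
  PowerFree α w = ∀ i ℓ → ¬ IsPower α (factor w i ℓ)

  SquareAt : (ℕ → A) → ℕ → Set
  SquareAt w i = ∃[ ℓ ] IsSquare (factor w i ℓ)

{-# OPTIONS --safe #-}

-- Let μ be the Thue–Morse morphism and let w = 0 μ²ᵏ(w), which begins with 00.
--
-- Overlaps: the image of 00 at the start of μ²ᵏ(w) is preceded by 0, the last letter of μ²ᵏ(0), so
-- an overlap begins at position 0 of w. An overlap at position ⌊i/2⌋ of v yields one at position i
-- of μ(v), hence by strong induction an overlap begins at every position of w.
--
-- Powers: μ(v) has no overlap and no prefix square of odd period, and those of period 2p come from
-- v, with period p and about half the excess e. Since prepending 0 adds at most 1 to the excess,
-- induction on the period gives k e < p for every repetition of length 2p + e > 2p in w. If k is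
-- the denominator of a rational q with 2 < q < α, so that q ≥ 2 + 1/k, all exponents are at most q.

module Submission where

open import Defs
open import Data.Fin.Base using (Fin; zero; suc; opposite)
open import Data.Fin.Properties using (opposite-involutive)
open import Data.Integer.Base as ℤ using (+_; -[1+_])
import Data.Integer.Properties as ℤ
open import Data.List.Base using (List; []; _∷_; _++_; concat; replicate; length; applyUpTo)
open import Data.List.NonEmpty as List⁺ using (List⁺; _∷_; toList)
open import Data.List.Properties
  using (++-assoc; ++-identityʳ; ∷-injectiveˡ; ∷-injectiveʳ; length-++; length-applyUpTo)
open import Data.List.Relation.Binary.Pointwise using (Pointwise-≡⇒≡)
open import Data.List.Relation.Binary.Prefix.Heterogeneous as Prefix using (Prefix; toView)
open import Data.Nat.Base
  using (ℕ; zero; suc; _+_; _*_; _∸_; _≤_; _<_; z≤n; s≤s; ⌊_/2⌋; ⌈_/2⌉; parity)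
open import Data.Nat.Coprimality using (Coprime)
open import Data.Nat.GeneralisedArithmetic using (fold)
open import Data.Nat.Induction using (<-rec)
open import Data.Nat.Properties
open import Data.Nat.Solver using (module +-*-Solver)
open import Data.Parity.Base as ℙ using (0ℙ; 1ℙ)
open import Data.Parity.Properties using (suc-homo-⁻¹; +-homo-+)
open import Data.Product.Base using (∃-syntax; Σ-syntax; _×_; _,_)
open import Data.Rational.Base as ℚ using (mkℚ; *<*; toℚᵘ; _/_)
import Data.Rational.Properties as ℚ
open import Data.Rational.Unnormalised.Base as ℚᵘ using (mkℚᵘ; *≤*)
import Data.Rational.Unnormalised.Properties as ℚᵘ
open import Data.Sum.Base using (_⊎_; inj₁; inj₂)
open import Function.Base using (_∘_)
open import Relation.Binary.PropositionalEquality
open import Relation.Nullary.Negation using (¬_; contradiction)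

-- The Thue-Morse morphism, its blocks and parities of positions.

Word : Set
Word = ℕ → Fin 2

μ : Word → Word
μ v zero          = v 0
μ v (suc zero)    = opposite (v 0)
μ v (suc (suc n)) = μ (v ∘ suc) n

infixr 5 0∷_

0∷_ : Word → Word
(0∷ v) zero    = zero
(0∷ v) (suc n) = v n

-- An even power of the morphism, so that the image of each letter ends with that letter.
μ² : ℕ → Word → Word
μ² k v = fold v (μ ∘ μ) k

≢opposite : (a : Fin 2) → a ≢ opposite a
≢opposite zero       ()
≢opposite (suc zero) ()

opposite-injective : ∀ {a b : Fin 2} → opposite a ≡ opposite b → a ≡ b
opposite-injective {a} {b} eq =
  trans (sym (opposite-involutive a)) (trans (cong opposite eq) (opposite-involutive b))

μ-cong : ∀ {u v} n → u ⌊ n /2⌋ ≡ v ⌊ n /2⌋ → μ u n ≡ μ v n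
μ-cong zero          eq = eq
μ-cong (suc zero)    eq = cong opposite eq
μ-cong (suc (suc n)) eq = μ-cong n eq

μ-injective : ∀ {u v} n → μ u n ≡ μ v n → u ⌊ n /2⌋ ≡ v ⌊ n /2⌋
μ-injective zero          eq = eq
μ-injective (suc zero)    eq = opposite-injective eq
μ-injective (suc (suc n)) eq = μ-injective n eq

μ-shift : ∀ v h n → μ v (h * 2 + n) ≡ μ (v ∘ _+_ h) n
μ-shift v zero    n = refl
μ-shift v (suc h) n = μ-shift (v ∘ suc) h n

μ-block : ∀ v n → parity n ≡ 0ℙ → μ v (suc n) ≡ opposite (μ v n)
μ-block v zero          _  = refl
μ-block v (suc (suc n)) eq = μ-block (v ∘ suc) n eq

⌊h*2+n/2⌋≡h+⌊n/2⌋ : ∀ h n → ⌊ h * 2 + n /2⌋ ≡ h + ⌊ n /2⌋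
⌊h*2+n/2⌋≡h+⌊n/2⌋ zero    n = refl
⌊h*2+n/2⌋≡h+⌊n/2⌋ (suc h) n = cong suc (⌊h*2+n/2⌋≡h+⌊n/2⌋ h n)

⌊1+n*2/2⌋≡n : ∀ n → ⌊ suc (n * 2) /2⌋ ≡ n
⌊1+n*2/2⌋≡n zero    = refl
⌊1+n*2/2⌋≡n (suc n) = cong suc (⌊1+n*2/2⌋≡n n)

even⇒≡*2 : ∀ n → parity n ≡ 0ℙ → n ≡ ⌊ n /2⌋ * 2
even⇒≡*2 zero          _  = refl
even⇒≡*2 (suc (suc n)) eq = cong (_+_ 2) (even⇒≡*2 n eq)

n≤⌈n/2⌉*2 : ∀ n → n ≤ ⌈ n /2⌉ * 2
n≤⌈n/2⌉*2 zero          = z≤n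
n≤⌈n/2⌉*2 (suc zero)    = s≤s z≤n
n≤⌈n/2⌉*2 (suc (suc n)) = s≤s (s≤s (n≤⌈n/2⌉*2 n))

-- Repetitions under the morphism.

-- The factor of length 2p + e at position i has period p; e is its excess over a square.
Repetition : Word → ℕ → ℕ → ℕ → Set
Repetition v i p e = ∀ j → j < p + e → v (j + i) ≡ v (p + (j + i))

-- A repetition of odd period transports the block structure of μ v to the other parity, so the
-- letters alternate over a whole period and its two ends differ.
μ-odd-period : ∀ {v} i p e → parity p ≡ 1ℙ → 0 < e ⊎ i ≡ 0 → ¬ Repetition (μ v) i p e
μ-odd-period {v} i p e odd anchored rep =
  ≢opposite (x i) (trans (rep 0 (<-≤-trans (odd⇒0< p odd) (m≤m+n p e))) (ends p odd ≤-refl))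
  where
  x = μ v

  odd⇒0< : ∀ q → parity q ≡ 1ℙ → 0 < q
  odd⇒0< (suc q) _ = s≤s z≤n

  suc-bound : ∀ j → j < p → parity (j + i) ≡ 1ℙ → 0 < e ⊎ i ≡ 0 → suc j < p + e
  suc-bound j j<p _    (inj₁ 0<e) = ≤-<-trans j<p (m<m+n p 0<e)
  suc-bound j j<p oddj (inj₂ refl) with m≤n⇒m<n∨m≡n j<p
  ... | inj₁ 1+j<p = <-≤-trans 1+j<p (m≤m+n p e)
  -- The only index whose successor can leave the range is `p - 1`; it is even because `p` is odd,
  -- contrary to `oddj`.
  ... | inj₂ refl with trans (cong ℙ._⁻¹ (sym odd)) (trans (suc-homo-⁻¹ j)
                         (trans (cong parity (sym (+-identityʳ j))) oddj))
  ...   | ()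

  step : ∀ j → j < p → x (suc j + i) ≡ opposite (x (j + i))
  step j j<p with parity (j + i) in eq
  ... | 0ℙ = μ-block v (j + i) eq
  ... | 1ℙ = begin
    x (suc (j + i))             ≡⟨ rep (suc j) (suc-bound j j<p eq anchored) ⟩
    x (p + suc (j + i))         ≡⟨ cong x (+-suc p (j + i)) ⟩
    x (suc (p + (j + i)))       ≡⟨ μ-block v (p + (j + i))
                                     (trans (+-homo-+ p (j + i)) (cong₂ ℙ._+_ odd eq)) ⟩
    opposite (x (p + (j + i)))  ≡⟨ cong opposite (rep j (<-≤-trans j<p (m≤m+n p e))) ⟨
    opposite (x (j + i))        ∎
    where open ≡-Reasoning

  ends : ∀ q → parity q ≡ 1ℙ → q ≤ p → x (q + i) ≡ opposite (x i)
  ends (suc zero)    _  q≤p = step 0 q≤p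
  ends (suc (suc q)) oq q≤p = trans (step (suc q) q≤p) (trans (cong opposite (step q (<⇒≤ q≤p)))
    (trans (opposite-involutive _) (ends q oq (≤-trans (n≤1+n q) (<⇒≤ q≤p)))))

-- Sampling every second letter reads the same offset in each block, and this letter determines the
-- block. The samples in range are those with `2j < 2h + e`, whence the rounding up.
μ-even-period : ∀ {v} i h e → Repetition (μ v) i (h * 2) e → Repetition v ⌊ i /2⌋ h ⌈ e /2⌉
μ-even-period {v} i h e rep j j< = μ-injective i (begin
  μ (v ∘ _+_ j) i               ≡⟨ μ-shift v j i ⟨
  μ v (j * 2 + i)                 ≡⟨ rep (j * 2) j*2< ⟩
  μ v (h * 2 + (j * 2 + i))       ≡⟨ μ-shift v h (j * 2 + i) ⟩
  μ (v ∘ _+_ h) (j * 2 + i)     ≡⟨ μ-shift (v ∘ _+_ h) j i ⟩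
  μ (v ∘ _+_ h ∘ _+_ j) i    ∎)
  where
  open ≡-Reasoning
  j*2< : j * 2 < h * 2 + e
  j*2< = ≰⇒> λ le → <⇒≱ j< (subst₂ _≤_
    (trans (cong ⌊_/2⌋ (sym (+-suc (h * 2) e))) (⌊h*2+n/2⌋≡h+⌊n/2⌋ h (suc e)))
    (⌊1+n*2/2⌋≡n j) (⌊n/2⌋-mono (s≤s le)))

-- Prefix squares (i = 0, e = 0) are included because prepending a letter can turn them into overlaps.
record Bound (N P : ℕ) (v : Word) (d : ℕ) : Set where
  field
    bounded : ∀ i p e → 0 < p → p ≤ P → 0 < e ⊎ i ≡ 0 → Repetition v i p e → N * e + d ≤ p

open Bound

-- Odd periods do not occur, and doubling the inequality for half the period gives slack
-- `2 (d + 1) ≥ d + 2`. Thus each `μ` gains at least one unit once the slack is positive.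
μ-Bound : ∀ {N P v d} → Bound N P v (suc d) → Bound N (suc (P * 2)) (μ v) (suc (suc d))
bounded (μ-Bound {N} {P} {v} {d} bound) i p e 0<p p≤ anchored rep with parity p in eq
... | 1ℙ = contradiction rep (μ-odd-period i p e eq anchored)
... | 0ℙ = begin
  N * e + suc (suc d)            ≤⟨ +-mono-≤ (*-monoʳ-≤ N (n≤⌈n/2⌉*2 e))
                                      (s≤s (s≤s (m≤m*n d 2))) ⟩
  N * (⌈ e /2⌉ * 2) + suc d * 2  ≡⟨ cong (_+ suc d * 2) (*-assoc N ⌈ e /2⌉ 2) ⟨
  N * ⌈ e /2⌉ * 2 + suc d * 2    ≡⟨ *-distribʳ-+ 2 (N * ⌈ e /2⌉) (suc d) ⟨
  (N * ⌈ e /2⌉ + suc d) * 2      ≤⟨ *-monoˡ-≤ 2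
                                      (bounded bound ⌊ i /2⌋ h ⌈ e /2⌉ 0<h h≤P (anchored′ anchored) halved) ⟩
  h * 2                          ≡⟨ p≡h*2 ⟨
  p                              ∎
  where
  open ≤-Reasoning
  h = ⌊ p /2⌋
  p≡h*2 = even⇒≡*2 p eq

  halved : Repetition v ⌊ i /2⌋ h ⌈ e /2⌉
  halved = μ-even-period i h e (subst (λ q → Repetition (μ v) i q e) p≡h*2 rep)

  0<h : 0 < h
  0<h = *-cancelʳ-< 2 0 h (subst (0 <_) p≡h*2 0<p)

  h≤P : h ≤ P
  h≤P = subst (h ≤_) (⌊1+n*2/2⌋≡n P) (⌊n/2⌋-mono p≤)

  anchored′ : 0 < e ⊎ i ≡ 0 → 0 < ⌈ e /2⌉ ⊎ ⌊ i /2⌋ ≡ 0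
  anchored′ (inj₁ 0<e)  = inj₁ (⌊n/2⌋-mono (s≤s 0<e))
  anchored′ (inj₂ refl) = inj₂ refl

Bound-weaken : ∀ {N P Q v d c} → Q ≤ P → c ≤ d → Bound N P v d → Bound N Q v c
bounded (Bound-weaken {N} Q≤P c≤d bound) i p e 0<p p≤ anchored rep =
  ≤-trans (+-monoʳ-≤ (N * e) c≤d) (bounded bound i p e 0<p (≤-trans p≤ Q≤P) anchored rep)

-- A deliberately weak count: of the gains in slack and period, one unit per double step is kept,
-- which is all that prepending a letter will cost.
μ²-Bound : ∀ {N P v} k → Bound N P v 1 → Bound N (k + P) (μ² k v) (suc k)
μ²-Bound         zero    bound = bound
μ²-Bound {N} {P} (suc k) bound =
  Bound-weaken
    (s≤s (≤-trans (m≤m*n (k + P) 2) (≤-trans (n≤1+n _) (m≤m*n (suc ((k + P) * 2)) 2))))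
    (n≤1+n _)
    (μ-Bound (μ-Bound (μ²-Bound k bound)))

-- The fixed point of `extend k` as a limit.

extend : ℕ → Word → Word
extend k v = 0∷ μ² k v

μ²-agree : ∀ k {u v n} → (∀ m → m < n → u m ≡ v m) → ∀ m → m < n → μ² k u m ≡ μ² k v m
μ²-agree zero    agree m m<n = agree m m<n
μ²-agree (suc k) agree m m<n = μ-cong m (μ-cong ⌊ m /2⌋ (μ²-agree k agree _
  (≤-<-trans (≤-trans (⌊n/2⌋≤n ⌊ m /2⌋) (⌊n/2⌋≤n m)) m<n)))

-- The prepended letter gains one position of agreement, so the iterates of `extend k` converge
-- letter by letter.
extend-agree : ∀ k {u v n} → (∀ m → m < n → u m ≡ v m) →
               ∀ m → m < suc n → extend k u m ≡ extend k v m
extend-agree k agree zero    _         = refl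
extend-agree k agree (suc m) (s≤s m<n) = μ²-agree k agree m m<n

approx : ℕ → ℕ → Word
approx k = fold (λ _ → zero) (extend k)

word : ℕ → Word
word k n = approx k (suc n) n

approx-agree : ∀ k n j m → m < n → approx k n m ≡ approx k (n + j) m
approx-agree k (suc n) j = extend-agree k (approx-agree k n j)

approx-word : ∀ k n m → m < n → approx k n m ≡ word k m
approx-word k n m m<n with m≤n⇒∃[o]m+o≡n m<n
... | j , refl = sym (approx-agree k (suc m) j m ≤-refl)

word-suc : ∀ k n → word k (suc n) ≡ μ² k (word k) n
word-suc k n = μ²-agree k (approx-word k (suc n)) n ≤-refl

-- Bounding the excess in the fixed point.

-- Only a repetition at position 0 involves the new letter. Removing it lowers the excess by one,
-- possibly to a prefix square, and the lost term `k` is paid out of the slack `suc k`.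
word-Bound-step : ∀ k {P} → Bound k P (μ² k (word k)) (suc k) → Bound k P (word k) 1
bounded (word-Bound-step k bound) i p zero 0<p _ _ _ = subst (λ n → n + 1 ≤ p) (sym (*-zeroʳ k)) 0<p
bounded (word-Bound-step k bound) zero p (suc e) 0<p p≤ _ rep = begin
  k * suc e + 1     ≡⟨ cong (_+ 1) (*-suc k e) ⟩
  k + k * e + 1     ≡⟨ cong (_+ 1) (+-comm k (k * e)) ⟩
  k * e + k + 1     ≡⟨ +-assoc (k * e) k 1 ⟩
  k * e + (k + 1)   ≡⟨ cong (_+_ (k * e)) (+-comm k 1) ⟩
  k * e + suc k     ≤⟨ bounded bound 0 p e 0<p p≤ (inj₂ refl) tail ⟩
  p                 ∎
  where
  open ≤-Reasoning
  tail : Repetition (μ² k (word k)) 0 p e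
  tail j j< = trans (sym (word-suc k (j + 0))) (trans
    (rep (suc j) (subst (suc j <_) (sym (+-suc p e)) (s≤s j<)))
    (trans (cong (word k) (+-suc p (j + 0))) (word-suc k (p + (j + 0)))))
bounded (word-Bound-step k bound) (suc i) p (suc e) 0<p p≤ _ rep = ≤-trans
  (+-monoʳ-≤ (k * suc e) (s≤s z≤n))
  (bounded bound i p (suc e) 0<p p≤ (inj₁ (s≤s z≤n)) tail)
  where
  tail : Repetition (μ² k (word k)) i p (suc e)
  tail j j< = trans (sym (word-suc k (j + i))) (trans
    (trans (cong (word k) (sym (+-suc j i)))
      (trans (rep j j<) (cong (λ n → word k (p + n)) (+-suc j i))))
    (trans (cong (word k) (+-suc p (j + i))) (word-suc k (p + (j + i)))))

-- The induction on the period bound advances because `k` is positive: passing to `μ² k` raises the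
-- bound from `P` to at least `P + 1`.
word-Bound : ∀ k → 0 < k → ∀ P → Bound k P (word k) 1
bounded (word-Bound k 0<k zero) i p e 0<p p≤0 = contradiction p≤0 (<⇒≱ 0<p)
word-Bound k 0<k (suc P) = word-Bound-step k
  (Bound-weaken (+-monoˡ-≤ P 0<k) ≤-refl (μ²-Bound k (word-Bound k 0<k P)))

-- Overlaps at every position.

μ-lift : ∀ {v} p n → v ⌊ n /2⌋ ≡ v (p + ⌊ n /2⌋) → μ v n ≡ μ v (p * 2 + n)
μ-lift {v} p n eq = trans (μ-cong n eq) (sym (μ-shift v p n))

-- An overlap of period suc p begins at i: agreement on the closed interval [i , i + suc p].
OverlapAt : Word → ℕ → Set
OverlapAt v i = ∃[ p ] (∀ n → i ≤ n → n ≤ suc p + i → v n ≡ v (suc p + n))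

-- Overlaps rather than squares, since the excess letter covers the odd positions as well.
μ-OverlapAt : ∀ {v} i → OverlapAt v ⌊ i /2⌋ → OverlapAt (μ v) i
μ-OverlapAt i (p , eq) = suc (p * 2) , λ n i≤n n≤ → μ-lift (suc p) n
  (eq ⌊ n /2⌋ (⌊n/2⌋-mono i≤n)
    (subst (⌊ n /2⌋ ≤_) (⌊h*2+n/2⌋≡h+⌊n/2⌋ (suc p) i) (⌊n/2⌋-mono n≤)))

μ²-OverlapAt : ∀ k {v n} → (∀ i → i ≤ n → OverlapAt v i) → ∀ i → i ≤ n → OverlapAt (μ² k v) i
μ²-OverlapAt zero    overlaps = overlaps
μ²-OverlapAt (suc k) overlaps i i≤n = μ-OverlapAt i (μ-OverlapAt ⌊ i /2⌋
  (μ²-OverlapAt k overlaps _ (≤-trans (⌊n/2⌋≤n ⌊ i /2⌋) (≤-trans (⌊n/2⌋≤n i) i≤n))))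

-- The root, of length `suc p`, ends in the letter to be prepended, so prepending it makes the
-- square an overlap.
PrefixSquare : Word → Set
PrefixSquare v = ∃[ p ] v p ≡ zero × (∀ n → n ≤ p → v n ≡ v (suc p + n))

μ²-PrefixSquare : ∀ k {v} → PrefixSquare v → PrefixSquare (μ² k v)
μ²-PrefixSquare zero    sq = sq
μ²-PrefixSquare (suc k) {v} sq with μ²-PrefixSquare k sq
-- The new period is `4 (p + 1)`, recorded by its predecessor. Each `μ` flips the last letter of the
-- root, so two restore it.
... | p , last , eq = suc (suc (suc (p * 2 * 2)))
  , trans (μ-last (μ x) (suc (p * 2)))
      (trans (cong opposite (μ-last x p)) (trans (opposite-involutive _) last))
  , lift (suc (p * 2)) (lift p eq)
  where
  x = μ² k v

  μ-last : ∀ u n → μ u (suc (n * 2)) ≡ opposite (u n)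
  μ-last u zero    = refl
  μ-last u (suc n) = μ-last (u ∘ suc) n

  lift : ∀ {u} q → (∀ n → n ≤ q → u n ≡ u (suc q + n)) →
         ∀ n → n ≤ suc (q * 2) → μ u n ≡ μ u (suc (suc (q * 2)) + n)
  lift q eq n n≤ = μ-lift (suc q) n (eq ⌊ n /2⌋
    (subst (⌊ n /2⌋ ≤_) (⌊1+n*2/2⌋≡n q) (⌊n/2⌋-mono n≤)))

μ²-head : ∀ k v → μ² k v 0 ≡ v 0
μ²-head zero    v = refl
μ²-head (suc k) v = μ²-head k v

word-overlap : ∀ k i → OverlapAt (word k) i
word-overlap k = <-rec (OverlapAt (word k)) step
  where
  w = word k

  w-suc-+ : ∀ p n → w (suc p + suc n) ≡ μ² k w (suc p + n)
  w-suc-+ p n = trans (cong (w ∘ suc) (+-suc p n)) (word-suc k (suc p + n))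

  w1≡w0 : w 1 ≡ w 0
  w1≡w0 = trans (word-suc k 0) (μ²-head k w)

  step : ∀ i → (∀ {j} → j < i → OverlapAt w j) → OverlapAt w i
  -- The seed is the square 00 of period 1 at the start of `w`.
  step zero _ with μ²-PrefixSquare k {w} (0 , refl , λ { zero z≤n → sym w1≡w0 })
  ... | p , last , eq = p , λ where
    zero    _ _ → sym (trans (cong w (+-identityʳ (suc p))) (trans (word-suc k p) last))
    (suc n) _ (s≤s n≤) → trans (word-suc k n)
      (trans (eq n (subst (n ≤_) (+-identityʳ p) n≤)) (sym (w-suc-+ p n)))
  -- Position `suc i` of `w` is position `i` of `μ² k w`, and halving never increases a position, so
  -- only overlaps of `w` up to `i` are used.
  step (suc i) rec with μ²-OverlapAt k (λ j j≤i → rec (s≤s j≤i)) i ≤-refl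
  ... | p , eq = p , λ where
    (suc n) (s≤s i≤n) (s≤s n≤) → trans (word-suc k n)
      (trans (eq n i≤n (subst (n ≤_) (+-suc p i) n≤)) (sym (w-suc-+ p n)))

-- Periods and exponents of finite powers.

module _ {A : Set} where

  applyUpTo-cong : ∀ {f g : ℕ → A} n → (∀ k → k < n → f k ≡ g k) →
                   applyUpTo f n ≡ applyUpTo g n
  applyUpTo-cong zero    eq = refl
  applyUpTo-cong (suc n) eq = cong₂ _∷_ (eq 0 (s≤s z≤n))
    (applyUpTo-cong n (λ k k<n → eq (suc k) (s≤s k<n)))

  applyUpTo-+ : ∀ (f : ℕ → A) m n → applyUpTo f (m + n) ≡ applyUpTo f m ++ applyUpTo (f ∘ _+_ m) n
  applyUpTo-+ f zero    n = refl
  applyUpTo-+ f (suc m) n = cong (f 0 ∷_) (applyUpTo-+ (f ∘ suc) m n)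

  -- Two functions serve even a single word, since the recursion on `x` shifts only `f`.
  applyUpTo-prefix : ∀ (f g : ℕ → A) {m n} x y → applyUpTo f m ++ y ≡ x ++ applyUpTo g n →
                     ∀ j → length x + j < m → j < n → f (length x + j) ≡ g j
  applyUpTo-prefix f g (_ ∷ x) y eq j (s≤s x+j<m) j<n =
    applyUpTo-prefix (f ∘ suc) g x y (∷-injectiveʳ eq) j x+j<m j<n
  applyUpTo-prefix f g [] y eq zero    (s≤s _)   (s≤s _)   = ∷-injectiveˡ eq
  applyUpTo-prefix f g [] y eq (suc j) (s≤s j<m) (s≤s j<n) =
    applyUpTo-prefix (f ∘ suc) (g ∘ suc) [] y (∷-injectiveʳ eq) j j<m j<n

  power-comm : ∀ n (x : List A) → x ++ concat (replicate n x) ≡ concat (replicate n x) ++ x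
  power-comm zero    x = ++-identityʳ x
  power-comm (suc n) x = trans (cong (x ++_) (power-comm n x)) (sym (++-assoc x _ x))

  -- Periodicity without indices: the power is a prefix of `x` followed by itself. If `x` is
  -- `x′ ++ y`, the remainder is `y ++ x′`.
  power-period : ∀ n {x x′ : List A} → Prefix _≡_ x′ x →
                 ∃[ y ] (concat (replicate n x) ++ x′) ++ y ≡ x ++ (concat (replicate n x) ++ x′)
  power-period n {x} {x′} prefix with toView prefix
  ... | eqs Prefix.++ y with Pointwise-≡⇒≡ eqs
  ...   | refl = y ++ x′ , (begin
    (xⁿ ++ x′) ++ (y ++ x′)  ≡⟨ ++-assoc xⁿ x′ _ ⟩
    xⁿ ++ (x′ ++ (y ++ x′))  ≡⟨ cong (xⁿ ++_) (++-assoc x′ y x′) ⟨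
    xⁿ ++ (x ++ x′)          ≡⟨ ++-assoc xⁿ x x′ ⟨
    (xⁿ ++ x) ++ x′          ≡⟨ cong (_++ x′) (power-comm n x) ⟨
    (x ++ xⁿ) ++ x′          ≡⟨ ++-assoc x xⁿ x′ ⟩
    x ++ (xⁿ ++ x′)          ∎)
    where
    open ≡-Reasoning
    xⁿ = concat (replicate n x)

  length-power : ∀ n (x x′ : List A) → length (concat (replicate n x) ++ x′) ≡ n * length x + length x′
  length-power zero    x x′ = refl
  length-power (suc n) x x′ = trans (cong length (++-assoc x _ x′)) (trans (length-++ x)
    (trans (cong (_+_ (length x)) (length-power n x x′)) (sym (+-assoc (length x) _ _))))

  exponent-≤ : ∀ n (x : List⁺ A) x′ {m d} .{c : Coprime m (suc d)} →
               (n * List⁺.length x + length x′) * suc d ≤ m * List⁺.length x →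
               exponent n x x′ ℚ.≤ mkℚ (+ m) d c
  exponent-≤ n x x′ {m} {d} {c} le = ℚ.toℚᵘ-cancel-≤ (begin
    toℚᵘ (exponent n x x′)              ≃⟨ ℚ.toℚᵘ-homo-+ (+ n / 1) (+ r / p) ⟩
    toℚᵘ (+ n / 1) ℚᵘ.+ toℚᵘ (+ r / p)  ≃⟨ ℚᵘ.+-cong (ℚ.toℚᵘ-fromℚᵘ (+ n ℚᵘ./ 1))
                                             (ℚ.toℚᵘ-fromℚᵘ (+ r ℚᵘ./ p)) ⟩
    + n ℚᵘ./ 1 ℚᵘ.+ + r ℚᵘ./ p          ≤⟨ *≤* (subst₂ ℤ._≤_ lhs rhs (ℤ.+≤+ le)) ⟩
    mkℚᵘ (+ m) d                        ∎)
    where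
    open ℚᵘ.≤-Reasoning
    p = List⁺.length x
    r = length x′
    lhs : + ((n * p + r) * suc d) ≡ (+ n ℤ.* + p ℤ.+ + r ℤ.* + 1) ℤ.* + suc d
    lhs = trans (ℤ.pos-* (n * p + r) (suc d)) (cong (ℤ._* + suc d) (trans (ℤ.pos-+ (n * p) r)
      (cong₂ ℤ._+_ (ℤ.pos-* n p) (sym (ℤ.*-identityʳ (+ r))))))
    rhs : + (m * p) ≡ + m ℤ.* + (1 * p)
    rhs = trans (ℤ.pos-* m p) (cong (λ n → + m ℤ.* + n) (sym (*-identityˡ p)))

-- Squares and powers among the factors of the word.

overlap⇒SquareAt : ∀ {w i} → OverlapAt w i → SquareAt w i
overlap⇒SquareAt {w} {i} (p , eq) = suc p + suc p , (f 0 ∷ applyUpTo (f ∘ suc) p) ,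
  trans (applyUpTo-+ f (suc p) (suc p))
    (cong (applyUpTo f (suc p) ++_) (applyUpTo-cong (suc p) λ k k<1+p → sym (periodic k k<1+p)))
  where
  open ≡-Reasoning
  f = λ k → w (i + k)

  periodic : ∀ k → k < suc p → f k ≡ f (suc p + k)
  periodic k k<1+p = begin
    w (i + k)            ≡⟨ eq (i + k) (m≤m+n i k)
                              (subst (_≤ suc p + i) (+-comm k i) (+-monoˡ-≤ i (<⇒≤ k<1+p))) ⟩
    w (suc p + (i + k))  ≡⟨ cong w (+-assoc (suc p) i k) ⟨
    w (suc p + i + k)    ≡⟨ cong (λ n → w (n + k)) (+-comm (suc p) i) ⟩
    w (i + suc p + k)    ≡⟨ cong w (+-assoc i (suc p) k) ⟩
    w (i + (suc p + k))  ∎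

factor-Repetition : ∀ (w : Word) i {e ℓ y} x → length x + (length x + e) ≡ ℓ →
                    factor w i ℓ ++ y ≡ x ++ factor w i ℓ → Repetition w i (length x) e
factor-Repetition w i {y = y} x refl eq j j< = begin
  w (j + i)        ≡⟨ cong w (+-comm j i) ⟩
  w (i + j)        ≡⟨ applyUpTo-prefix f f x y eq j (+-monoʳ-< p j<) (<-≤-trans j< (m≤n+m _ p)) ⟨
  w (i + (p + j))  ≡⟨ cong w (+-comm i (p + j)) ⟩
  w (p + j + i)    ≡⟨ cong w (+-assoc p j i) ⟩
  w (p + (j + i))  ∎
  where
  open ≡-Reasoning
  p = length x
  f = λ k → w (i + k)

word-power-≤ : ∀ d {m} i ℓ n x {x′} → 2 * suc d < m → Prefix _≡_ x′ (toList x) →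
               factor (word (suc d)) i ℓ ≡ concat (replicate n (toList x)) ++ x′ →
               (n * List⁺.length x + length x′) * suc d ≤ m * List⁺.length x
word-power-≤ d {m} i ℓ n x {x′} 2D<m prefix eq = begin
  (n * p + length x′) * D        ≡⟨ cong (_* D) ℓ≡ ⟨
  -- Truncated subtraction gives excess 0 to powers shorter than a square, so they need no separate
  -- case.
  ℓ * D                          ≤⟨ *-monoˡ-≤ D (m≤n+m∸n ℓ (p + p)) ⟩
  (p + p + (ℓ ∸ (p + p))) * D    ≡⟨ solve 3 (λ p e D →
                                      (p :+ p :+ e) :* D := con 2 :* D :* p :+ D :* e)
                                      refl p (ℓ ∸ (p + p)) D ⟩
  2 * D * p + D * (ℓ ∸ (p + p))  ≤⟨ +-monoʳ-≤ (2 * D * p) (excess-≤ _ refl) ⟩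
  2 * D * p + p                  ≡⟨ +-comm (2 * D * p) p ⟩
  suc (2 * D) * p                ≤⟨ *-monoˡ-≤ p 2D<m ⟩
  m * p                          ∎
  where
  open ≤-Reasoning
  open +-*-Solver
  p = List⁺.length x
  D = suc d

  ℓ≡ : ℓ ≡ n * p + length x′
  ℓ≡ = trans (sym (length-applyUpTo _ ℓ)) (trans (cong length eq) (length-power n (toList x) x′))

  excess-≤ : ∀ e → ℓ ∸ (p + p) ≡ e → D * e ≤ p
  excess-≤ zero    _  = subst (_≤ p) (sym (*-zeroʳ D)) z≤n
  excess-≤ (suc e) ℓ∸2p≡1+e with power-period n prefix
  ... | y , periodic = ≤-trans (m≤m+n (D * suc e) 1)
    (bounded (word-Bound D (s≤s z≤n) p) i p (suc e) (s≤s z≤n) ≤-refl (inj₁ (s≤s z≤n))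
      (factor-Repetition (word D) i (toList x) 2p+1+e≡ℓ
        (trans (cong (_++ y) eq) (trans periodic (cong (toList x ++_) (sym eq))))))
    where
    2p≤ℓ : p + p ≤ ℓ
    2p≤ℓ = <⇒≤ (m∸n≢0⇒n<m λ ℓ∸2p≡0 → 1+n≢0 (trans (sym ℓ∸2p≡1+e) ℓ∸2p≡0))

    2p+1+e≡ℓ : p + (p + suc e) ≡ ℓ
    2p+1+e≡ℓ = trans (sym (+-assoc p p (suc e)))
      (trans (cong (_+_ (p + p)) (sym ℓ∸2p≡1+e)) (m+[n∸m]≡n 2p≤ℓ))

theorem7 : (α : ℝ) → fromℚ (+ 2 / 1) <ᴿ α →
    Σ[ w ∈ (ℕ → Fin 2) ] (PowerFree α w × (∀ i → SquareAt w i))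
theorem7 α (mkℚ -[1+ _ ] _ _ , *<* () , _)
theorem7 α (mkℚ (+ m) d c , *<* 2<q , q<α) = word (suc d) ,
  (λ where
    -- If `α` were this exponent, the rational below `α` would be strictly below an exponent that it
    -- bounds from above.
    i ℓ (x , n , x′ , prefix , eq , (lowerα⊆lowerβ , _) , _) → ℚ.<-irrefl refl
      (ℚ.<-≤-trans (lowerα⊆lowerβ q<α)
        (exponent-≤ n x x′ (word-power-≤ d i ℓ n x 2D<m prefix eq)))) ,
  overlap⇒SquareAt ∘ word-overlap (suc d)
  where
  2D<m : 2 * suc d < m
  2D<m = ℤ.drop‿+<+ (subst (+ (2 * suc d) ℤ.<_) (ℤ.*-identityʳ (+ m)) 2<q)
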